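{- Let $\tilde L$ be a minimum-size counterexample. Then $\tilde L$ contains at most one doubly irreducible element.
   Context: For a poset $P$, $x$ upper covers $y$ (and $y$ lower covers $x$) if $y<x$ with nothing strictly between. Join-irreducible: upper covers exactly one element; meet-irreducible: lower covers exactly one element; doubly irreducible: both. For $x\in P$, ${\uparrow}x=\{y: x\le y\}$. A counterexample is a finite lattice $L$ with $|L|>1$ in which every join-irreducible $j$ satisfies $|{\uparrow}j|>|L|/2$; a minimum-size counterexample is a counterexample $\tilde L$ such that no counterexample has fewer elements. -}

module Defs where

open import Data.Fin.Base using (Fin)
open import Data.Fin.Properties using (inj⇒≟)
open import Data.Fin.Subset using (Subset; ∣_∣)
open import Data.Nat.Base using (ℕ; _*_) renaming (_<_ to _<ℕ_)
open import Data.Product using (_×_; ∃!)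
open import Data.Vec.Base using (tabulate)
open import Function.Bundles using (Inverse)
open import Function.Properties.Inverse using (Inverse⇒Injection)
open import Level using (Level; _⊔_) renaming (suc to lsuc)
open import Relation.Binary.Bundles using (Poset)
open import Relation.Binary.Definitions using (Decidable)
open import Relation.Binary.Lattice.Bundles using (Lattice)
import Relation.Binary.Lattice.Properties.MeetSemilattice as MeetSemilatticeProperties
import Relation.Binary.Properties.Poset as PosetProperties
open import Relation.Binary.PropositionalEquality.Properties using () renaming (setoid to ≡-setoid)
open import Relation.Nullary using (¬_)
open import Relation.Nullary.Decidable using (does)

module Irreducibility {c ℓ₁ ℓ₂ : Level} (P : Poset c ℓ₁ ℓ₂) where
  open Poset P using (Carrier; _≈_)
  open PosetProperties P using (_<_)

  infix 4 _UpperCovers_ _LowerCovers_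

  _UpperCovers_ : Carrier → Carrier → Set (c ⊔ ℓ₁ ⊔ ℓ₂)
  x UpperCovers y = y < x × (∀ z → ¬ (y < z × z < x))

  _LowerCovers_ : Carrier → Carrier → Set (c ⊔ ℓ₁ ⊔ ℓ₂)
  y LowerCovers x = x UpperCovers y

  JoinIrreducible : Carrier → Set (c ⊔ ℓ₁ ⊔ ℓ₂)
  JoinIrreducible x = ∃! _≈_ λ y → x UpperCovers y

  MeetIrreducible : Carrier → Set (c ⊔ ℓ₁ ⊔ ℓ₂)
  MeetIrreducible x = ∃! _≈_ λ y → x LowerCovers y

  DoublyIrreducible : Carrier → Set (c ⊔ ℓ₁ ⊔ ℓ₂)
  DoublyIrreducible x = JoinIrreducible x × MeetIrreducible x

-- The equality of the lattice is an arbitrary setoid equality, so `size` counts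
-- elements up to _≈_.
record FiniteLattice (c ℓ₁ ℓ₂ : Level) : Set (lsuc (c ⊔ ℓ₁ ⊔ ℓ₂)) where
  field
    lattice     : Lattice c ℓ₁ ℓ₂
    size        : ℕ
    enumeration : Inverse (Lattice.setoid lattice) (≡-setoid (Fin size))

  open Lattice lattice public
  open Irreducibility poset public

  _≟_ : Decidable _≈_
  _≟_ = inj⇒≟ (Inverse⇒Injection enumeration)

  _≤?_ : Decidable _≤_
  _≤?_ = MeetSemilatticeProperties.≈-dec⇒≤-dec meetSemilattice _≟_

  -- The up-set of x, as the set of indices of its elements in the enumeration.
  ↑_ : Carrier → Subset size
  ↑ x = tabulate λ i → does (x ≤? Inverse.from enumeration i)

-- |↑j| > |L|/2 is written without division, as |L| < 2|↑j|.
IsCounterexample : {c ℓ₁ ℓ₂ : Level} → FiniteLattice c ℓ₁ ℓ₂ → Set (c ⊔ ℓ₁ ⊔ ℓ₂)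
IsCounterexample L =
  1 <ℕ size × (∀ j → JoinIrreducible j → size <ℕ 2 * ∣ ↑ j ∣)
  where open FiniteLattice L

-- Competitors range over the universe levels of L; this loses no generality, as
-- every finite lattice has an isomorphic copy at any given levels.
IsMinimumSizeCounterexample :
  {c ℓ₁ ℓ₂ : Level} → FiniteLattice c ℓ₁ ℓ₂ → Set (lsuc (c ⊔ ℓ₁ ⊔ ℓ₂))
IsMinimumSizeCounterexample {c} {ℓ₁} {ℓ₂} L =
  IsCounterexample L ×
  (∀ (M : FiniteLattice c ℓ₁ ℓ₂) → IsCounterexample M →
     ¬ (FiniteLattice.size M <ℕ FiniteLattice.size L))

{-# OPTIONS --safe #-}

-- If x ≉ y are doubly irreducible, deleting both leaves a sublattice M with
-- |M| = |L| − 2, and M is a smaller counterexample. For z join-irreducible in M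
-- it suffices to find w with |L| < 2|↑w| and |↑w| ≤ |↑z ∩ M| + 1. If z < x then
-- w = x works, as ↑z contains z besides ↑x and loses at most two elements; so
-- does w = y if z < y. Otherwise ↑z lies in M: if z is the upper cover of x then
-- w = x works, as ↑x = {x} ∪ ↑z; similarly for y; and if z covers neither x nor
-- y, it is join-irreducible in L, so that w = z works.

module Submission where

open import Defs
open import Level using (Level; Lift; lift; lower)
open import Data.Bool.Base using (Bool; true; false; if_then_else_)
open import Data.Empty using (⊥-elim)
open import Data.Fin.Base using (Fin; zero; suc; punchIn; punchOut)
open import Data.Fin.Properties using (any?; punchIn-injective; punchIn-punchOut; punchInᵢ≢i)
open import Data.Fin.Subset using (∣_∣)
open import Data.Fin.Subset.Properties using (∣p∣≤n)
import Data.Nat.Base as ℕ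
open ℕ using (ℕ; _+_; _*_; z≤n; s≤s)
open import Data.Nat.Induction using (<-wellFounded)
import Data.Nat.Properties as ℕ
open import Algebra.Properties.CommutativeSemigroup ℕ.+-commutativeSemigroup using (x∙yz≈y∙xz)
open import Data.Product using (∃; _×_; _,_; proj₁; proj₂; map₂; swap)
open import Data.Sum.Base using (_⊎_; inj₁; inj₂; [_,_]′)
open import Data.Vec.Base using (tabulate)
open import Data.Vec.Properties using (tabulate-cong)
open import Function.Base using (_∘_; flip; _on_)
open import Function.Bundles using (Inverse)
open import Function.Definitions using (Injective)
open import Induction.WellFounded using (Acc; acc; WellFounded; module Subrelation)
open import Relation.Binary.Core using (Rel)
open import Relation.Binary.Definitions using (Decidable; Transitive)
import Relation.Binary.Construct.On as On
import Relation.Binary.Properties.Poset as PosetProperties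
open import Relation.Binary.PropositionalEquality as ≡ using (_≡_; _≢_)
open import Relation.Nullary using (¬_; Dec; yes; no; does)
open import Relation.Nullary.Decidable using (map′; _×-dec_; ¬?; decidable-stable; dec-true;
  dec-false; does-≡)
import Relation.Unary as U

private
  variable
    a p q c ℓ ℓ₁ ℓ₂ : Level
    n : ℕ

-- Counting decidable subsets of `Fin n`.

card : (Fin n → Bool) → ℕ
card f = ∣ tabulate f ∣

indicator : Bool → ℕ
indicator b = if b then 1 else 0

indicator≤1 : ∀ b → indicator b ℕ.≤ 1
indicator≤1 true  = ℕ.≤-refl
indicator≤1 false = z≤n

card-suc : (f : Fin (ℕ.suc n) → Bool) → card f ≡ indicator (f zero) + card (f ∘ suc)
card-suc f with f zero
... | true  = ≡.refl
... | false = ≡.refl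

card-punchIn : (i : Fin (ℕ.suc n)) (f : Fin (ℕ.suc n) → Bool) →
               card f ≡ indicator (f i) + card (f ∘ punchIn i)
card-punchIn zero f = card-suc f
card-punchIn {ℕ.suc n} (suc i) f = begin
  card f
    ≡⟨ card-suc f ⟩
  indicator (f zero) + card (f ∘ suc)
    ≡⟨ ≡.cong (indicator (f zero) +_) (card-punchIn i (f ∘ suc)) ⟩
  indicator (f zero) + (indicator (f (suc i)) + card (f ∘ suc ∘ punchIn i))
    ≡⟨ x∙yz≈y∙xz (indicator (f zero)) (indicator (f (suc i))) _ ⟩
  indicator (f (suc i)) + (indicator (f zero) + card (f ∘ suc ∘ punchIn i))
    ≡⟨ ≡.cong (indicator (f (suc i)) +_) (card-suc (f ∘ punchIn (suc i))) ⟨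
  indicator (f (suc i)) + card (f ∘ punchIn (suc i))
    ∎
  where open ≡.≡-Reasoning

card-mono-≤ : {P : U.Pred (Fin n) p} {Q : U.Pred (Fin n) q}
              (P? : U.Decidable P) (Q? : U.Decidable Q) →
              (∀ k → P k → Q k) → card (does ∘ P?) ℕ.≤ card (does ∘ Q?)
card-mono-≤ {ℕ.zero}  P? Q? P⊆Q = z≤n
card-mono-≤ {ℕ.suc n} P? Q? P⊆Q
  with P? zero | Q? zero | card-mono-≤ (P? ∘ suc) (Q? ∘ suc) (P⊆Q ∘ suc)
... | yes _  | yes _  | r = s≤s r
... | yes p₀ | no ¬q₀ | r = ⊥-elim (¬q₀ (P⊆Q zero p₀))
... | no _   | yes _  | r = ℕ.m≤n⇒m≤1+n r
... | no _   | no _   | r = r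

card-mono-< : {P : U.Pred (Fin n) p} {Q : U.Pred (Fin n) q}
              (P? : U.Decidable P) (Q? : U.Decidable Q) (i : Fin n) → ¬ P i → Q i →
              (∀ k → P k → Q k) → card (does ∘ P?) ℕ.< card (does ∘ Q?)
card-mono-< {ℕ.suc n} P? Q? i ¬pᵢ qᵢ P⊆Q
  rewrite card-punchIn i (does ∘ P?) | card-punchIn i (does ∘ Q?)
        | dec-false (P? i) ¬pᵢ | dec-true (Q? i) qᵢ =
  s≤s (card-mono-≤ (P? ∘ punchIn i) (Q? ∘ punchIn i) (P⊆Q ∘ punchIn i))

-- The exceptional index `i` contributes at most one to the left-hand count.
card-≤-suc : {P : U.Pred (Fin n) p} {Q : U.Pred (Fin n) q}
             (P? : U.Decidable P) (Q? : U.Decidable Q) (i : Fin n) →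
             (∀ k → k ≢ i → P k → Q k) → card (does ∘ P?) ℕ.≤ 1 + card (does ∘ Q?)
card-≤-suc {ℕ.suc n} P? Q? i P⊆Q
  rewrite card-punchIn i (does ∘ P?) | card-punchIn i (does ∘ Q?) =
  ℕ.+-mono-≤ (indicator≤1 (does (P? i)))
    (ℕ.≤-trans (card-mono-≤ (P? ∘ punchIn i) (Q? ∘ punchIn i)
                            (λ k → P⊆Q (punchIn i k) (punchInᵢ≢i i k)))
               (ℕ.m≤n+m _ _))

-- Two distinct indices, and the removal of both from `Fin n`.

distinct⇒1< : {k l : Fin n} → k ≢ l → 1 ℕ.< n
distinct⇒1< {ℕ.suc ℕ.zero}    {zero} {zero} k≢l = ⊥-elim (k≢l ≡.refl)
distinct⇒1< {ℕ.suc (ℕ.suc _)} _ = s≤s (s≤s z≤n)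

-- An enumeration of `Fin n` without `i` and `j`. The field `card-split` keeps the contributions of
-- `i` and `j` explicit, so that up-sets before and after deletion can be compared.
record Complement {n} (i j : Fin n) : Set where
  field
    m          : ℕ
    size≡      : n ≡ 2 + m
    embed      : Fin m → Fin n
    injective  : Injective _≡_ _≡_ embed
    avoids     : ∀ k → embed k ≢ i × embed k ≢ j
    surjective : ∀ k → k ≢ i → k ≢ j → ∃ λ l → embed l ≡ k
    card-split : ∀ f → card f ≡ indicator (f i) + (indicator (f j) + card (f ∘ embed))

complement : {i j : Fin n} → i ≢ j → Complement i j
complement {ℕ.suc ℕ.zero} {zero} {zero} i≢j = ⊥-elim (i≢j ≡.refl)
complement {ℕ.suc (ℕ.suc m)} {i} {j} i≢j = record
  { m          = m
  ; size≡      = ≡.refl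
  ; embed      = punchIn i ∘ punchIn j′
  ; injective  = λ eq → punchIn-injective j′ _ _ (punchIn-injective i _ _ eq)
  ; avoids     = λ k → punchInᵢ≢i i _ ,
                       λ eq → punchInᵢ≢i j′ k (punchIn-injective i _ _ (≡.trans eq (≡.sym i↑j′≡j)))
  ; surjective = surj
  ; card-split = λ f → ≡.trans (card-punchIn i f) (≡.cong (indicator (f i) +_)
      (≡.trans (card-punchIn j′ (f ∘ punchIn i))
               (≡.cong (λ k → indicator (f k) + card (f ∘ punchIn i ∘ punchIn j′)) i↑j′≡j)))
  }
  where
  -- The position of `j` among the indices left once `i` is removed.
  j′ : Fin (ℕ.suc m)
  j′ = punchOut i≢j

  i↑j′≡j : punchIn i j′ ≡ j
  i↑j′≡j = punchIn-punchOut i≢j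

  surj : ∀ k → k ≢ i → k ≢ j → ∃ λ l → punchIn i (punchIn j′ l) ≡ k
  surj k k≢i k≢j =
    punchOut j′≢k′ , ≡.trans (≡.cong (punchIn i) (punchIn-punchOut j′≢k′)) i↑k′≡k
    where
    i↑k′≡k : punchIn i (punchOut (k≢i ∘ ≡.sym)) ≡ k
    i↑k′≡k = punchIn-punchOut (k≢i ∘ ≡.sym)

    j′≢k′ : j′ ≢ punchOut (k≢i ∘ ≡.sym)
    j′≢k′ eq = k≢j (≡.trans (≡.sym i↑k′≡k) (≡.trans (≡.cong (punchIn i) (≡.sym eq)) i↑j′≡j))

-- Starting at `x`, keep moving to an element strictly between the current one and `y`;
-- accessibility makes the walk stop, at an element with nothing left in between. The relation is
-- abstract so that the order and its opposite both qualify.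
last-between : {A : Set a} {_≺_ : Rel A ℓ} → Transitive _≺_ →
               (∀ x y → Dec (∃ λ z → x ≺ z × z ≺ y)) →
               ∀ {x y} → Acc (flip _≺_) x → x ≺ y →
               ∃ λ w → (x ≡ w ⊎ x ≺ w) × w ≺ y × (∀ z → ¬ (w ≺ z × z ≺ y))
last-between ≺-trans between? {x} {y} (acc rs) x≺y with between? x y
... | no ¬z = x , inj₁ ≡.refl , x≺y , λ z x≺z≺y → ¬z (z , x≺z≺y)
... | yes (z , x≺z , z≺y) with last-between ≺-trans between? (rs x≺z) z≺y
...   | w , inj₁ ≡.refl , rest = w , inj₂ x≺z , rest
...   | w , inj₂ z≺w , rest = w , inj₂ (≺-trans x≺z z≺w) , rest

-- Covers and irreducible elements in a finite lattice.

module FiniteLatticeProperties (L : FiniteLattice c ℓ₁ ℓ₂) where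
  open FiniteLattice L
  open PosetProperties poset public
    using (_<_; <-trans; <-respˡ-≈; <-respʳ-≈; <⇒≱)
  open Inverse enumeration public using (to; from; inverseˡ; inverseʳ)

  from∘to : ∀ x → from (to x) ≈ x
  from∘to x = inverseʳ ≡.refl

  from-≈⇒≡to : ∀ {k x} → from k ≈ x → k ≡ to x
  from-≈⇒≡to eq = ≡.sym (inverseˡ (Eq.sym eq))

  ≤-<-trans : ∀ {x y z} → x ≤ y → y < z → x < z
  ≤-<-trans x≤y y<z =
    trans x≤y (proj₁ y<z) , λ x≈z → <⇒≱ y<z (trans (reflexive (Eq.sym x≈z)) x≤y)

  <-≤-trans : ∀ {x y z} → x < y → y ≤ z → x < z
  <-≤-trans x<y y≤z =
    trans (proj₁ x<y) y≤z , λ x≈z → <⇒≱ x<y (trans y≤z (reflexive (Eq.sym x≈z)))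

  _<?_ : Decidable _<_
  x <? y = (x ≤? y) ×-dec ¬? (x ≟ y)

  between? : ∀ x y → Dec (∃ λ z → x < z × z < y)
  between? x y = map′
    (λ (k , x<k<y) → from k , x<k<y)
    (λ (z , x<z , z<y) → to z , <-respʳ-≈ (Eq.sym (from∘to z)) x<z ,
                                <-respˡ-≈ (Eq.sym (from∘to z)) z<y)
    (any? λ k → (x <? from k) ×-dec (from k <? y))

  -- The inclusion of up-sets is strict because `x` lies in its own up-set but not in that of `y`.
  -- This makes the size of the up-set a measure for well-founded recursion.
  ∣↑∣-anti-< : ∀ {x y} → x < y → ∣ ↑ y ∣ ℕ.< ∣ ↑ x ∣
  ∣↑∣-anti-< {x} {y} x<y = card-mono-< (λ k → y ≤? from k) (λ k → x ≤? from k) (to x)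
    (λ y≤x → <⇒≱ x<y (trans y≤x (reflexive (from∘to x))))
    (reflexive (Eq.sym (from∘to x)))
    (λ k → trans (proj₁ x<y))

  >-wellFounded : WellFounded (flip _<_)
  >-wellFounded = Subrelation.wellFounded ∣↑∣-anti-<
    (On.wellFounded (λ x → ∣ ↑ x ∣) <-wellFounded)

  <-wellFounded′ : WellFounded _<_
  <-wellFounded′ = Subrelation.wellFounded
    -- The number of elements outside the up-set decreases on going down; the bound by `size` keeps
    -- truncated subtraction strict.
    (λ {x} x<y → ℕ.∸-monoʳ-< (∣↑∣-anti-< x<y) (∣p∣≤n (↑ x)))
    (On.wellFounded (λ x → size ℕ.∸ ∣ ↑ x ∣) <-wellFounded)

  lower-cover : ∀ {x y} → x < y → ∃ λ w → x ≤ w × y UpperCovers w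
  lower-cover x<y with last-between <-trans between? (>-wellFounded _) x<y
  ... | w , x≼w , cov = w , [ (λ { ≡.refl → refl }) , proj₁ ]′ x≼w , cov

  upper-cover : ∀ {x y} → x < y → ∃ λ w → w ≤ y × w UpperCovers x
  upper-cover x<y
    -- In the opposite order the walk descends from `y` and stops at an upper cover of `x`.
    with last-between (flip <-trans) (λ y x → map′ (map₂ swap) (map₂ swap) (between? x y))
                      (<-wellFounded′ _) x<y
  ... | w , y≽w , x<w , none =
    w , [ (λ { ≡.refl → refl }) , proj₁ ]′ y≽w , x<w , λ z → none z ∘ swap

  -- Some lower cover of `x` lies above `z`, and uniqueness identifies it with `x₊`.
  <⇒≤lower-cover : ∀ {x} ((x₊ , _) : JoinIrreducible x) → ∀ {z} → z < x → z ≤ x₊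
  <⇒≤lower-cover (_ , _ , unique) z<x with lower-cover z<x
  ... | w , z≤w , x-covers-w = trans z≤w (reflexive (Eq.sym (unique x-covers-w)))

  >⇒≥upper-cover : ∀ {x} ((x⁺ , _) : MeetIrreducible x) → ∀ {z} → x < z → x⁺ ≤ z
  >⇒≥upper-cover (_ , _ , unique) x<z with upper-cover x<z
  ... | w , w≤z , w-covers-x = trans (reflexive (unique w-covers-x)) w≤z

  -- If the join were `x`, both `y` and `z` would be strictly below `x`, hence below `x₊`, and so
  -- would their join.
  joinIrreducible-∨ : ∀ {x} → JoinIrreducible x →
                      ∀ {y z} → ¬ y ≈ x → ¬ z ≈ x → ¬ (y ∨ z) ≈ x
  joinIrreducible-∨ ji@(_ , (x₊<x , _) , _) {y} {z} y≉x z≉x y∨z≈x =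
    <⇒≱ x₊<x (trans (reflexive (Eq.sym y∨z≈x)) (∨-least
      (<⇒≤lower-cover ji (trans (x≤x∨y y z) (reflexive y∨z≈x) , y≉x))
      (<⇒≤lower-cover ji (trans (y≤x∨y y z) (reflexive y∨z≈x) , z≉x))))

  meetIrreducible-∧ : ∀ {x} → MeetIrreducible x →
                      ∀ {y z} → ¬ y ≈ x → ¬ z ≈ x → ¬ (y ∧ z) ≈ x
  meetIrreducible-∧ mi@(_ , (x<x⁺ , _) , _) {y} {z} y≉x z≉x y∧z≈x =
    <⇒≱ x<x⁺ (trans (∧-greatest
      (>⇒≥upper-cover mi (trans (reflexive (Eq.sym y∧z≈x)) (x∧y≤x y z) , y≉x ∘ Eq.sym))
      (>⇒≥upper-cover mi (trans (reflexive (Eq.sym y∧z≈x)) (x∧y≤y y z) , z≉x ∘ Eq.sym)))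
      (reflexive y∧z≈x))

  common-lower-bound : ∀ {x y} → JoinIrreducible x → JoinIrreducible y → ∃ λ b → b < x × b < y
  common-lower-bound (x₊ , (x₊<x , _) , _) (y₊ , (y₊<y , _) , _) =
    x₊ ∧ y₊ , ≤-<-trans (x∧y≤x x₊ y₊) x₊<x , ≤-<-trans (x∧y≤y x₊ y₊) y₊<y

  common-upper-bound : ∀ {x y} → MeetIrreducible x → MeetIrreducible y → ∃ λ t → x < t × y < t
  common-upper-bound (x⁺ , (x<x⁺ , _) , _) (y⁺ , (y<y⁺ , _) , _) =
    x⁺ ∨ y⁺ , <-≤-trans x<x⁺ (x≤x∨y x⁺ y⁺) , <-≤-trans y<y⁺ (y≤x∨y x⁺ y⁺)

  -- As `z` is the only upper cover of `x`, everything strictly above `x` is above `z`; only `x`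
  -- itself is lost.
  ∣↑∣-upper-cover : ∀ {x z} → MeetIrreducible x → z UpperCovers x → ∣ ↑ x ∣ ℕ.≤ 1 + ∣ ↑ z ∣
  ∣↑∣-upper-cover {x} {z} mi@(_ , _ , unique) z-covers-x =
    card-≤-suc (λ k → x ≤? from k) (λ k → z ≤? from k) (to x) λ k k≢x x≤k →
      trans (reflexive (Eq.sym (unique z-covers-x)))
            (>⇒≥upper-cover mi (x≤k , λ x≈k → k≢x (from-≈⇒≡to (Eq.sym x≈k))))

  -- The finite lattice on an enumerated subset closed under joins and meets.

  module Sublattice
    (S : U.Pred Carrier ℓ)
    (∨-closed : ∀ {x y} → S x → S y → S (x ∨ y))
    (∧-closed : ∀ {x y} → S x → S y → S (x ∧ y))
    {m : ℕ} (embed : Fin m → Carrier)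
    (embed-∈ : ∀ k → S (embed k))
    (embed-injective : ∀ {k l} → embed k ≈ embed l → k ≡ l)
    (embed-surjective : ∀ {x} → S x → ∃ λ k → embed k ≈ x)
    where

    ι : Lift c (Fin m) → Carrier
    ι = embed ∘ lower

    -- Lifting Fin m keeps the carrier at level c, whatever the level of S is.
    sublattice : FiniteLattice c ℓ₁ ℓ₂
    sublattice = record
      { lattice = record
        { Carrier   = Lift c (Fin m)
        ; _≈_       = _≈_ on ι
        ; _≤_       = _≤_ on ι
        ; _∨_       = λ x y → lift (proj₁ (join x y))
        ; _∧_       = λ x y → lift (proj₁ (meet x y))
        ; isLattice = record
          { isPartialOrder = On.isPartialOrder ι isPartialOrder
          ; supremum       = λ x y → let (_ , eq) = join x y in
              trans (x≤x∨y _ _) (reflexive (Eq.sym eq)) ,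
              trans (y≤x∨y _ _) (reflexive (Eq.sym eq)) ,
              λ z x≤z y≤z → trans (reflexive eq) (∨-least x≤z y≤z)
          ; infimum        = λ x y → let (_ , eq) = meet x y in
              trans (reflexive eq) (x∧y≤x _ _) ,
              trans (reflexive eq) (x∧y≤y _ _) ,
              λ z z≤x z≤y → trans (∧-greatest z≤x z≤y) (reflexive (Eq.sym eq))
          }
        }
      ; size        = m
      ; enumeration = record
        { to        = lower
        ; from      = lift
        ; to-cong   = embed-injective
        ; from-cong = λ { ≡.refl → Eq.refl }
        ; inverse   = embed-injective , λ { ≡.refl → Eq.refl }
        }
      }
      where
      join : ∀ x y → ∃ λ k → embed k ≈ (ι x ∨ ι y)
      join x y = embed-surjective (∨-closed (embed-∈ (lower x)) (embed-∈ (lower y)))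

      meet : ∀ x y → ∃ λ k → embed k ≈ (ι x ∧ ι y)
      meet x y = embed-surjective (∧-closed (embed-∈ (lower x)) (embed-∈ (lower y)))

    private module M = FiniteLattice sublattice

    ∣↑∣-sublattice : ∀ z → ∣ M.↑ z ∣ ≡ card (λ k → does (ι z ≤? embed k))
    ∣↑∣-sublattice z =
      -- `M.≤?` decides through the meet of the sublattice, so the two sides are different
      -- procedures for the same proposition.
      ≡.cong ∣_∣ (tabulate-cong λ k → does-≡ (z M.≤? lift k) (ι z ≤? embed k))

  -- Deleting two distinct doubly irreducible elements.

  module Deletion
    {x y : Carrier}
    (x-irr : DoublyIrreducible x) (y-irr : DoublyIrreducible y) (x≉y : ¬ x ≈ y)
    where
    index-≢ : ∀ {z w} → ¬ z ≈ w → to z ≢ to w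
    index-≢ {z} {w} z≉w eq = z≉w (Eq.trans (Eq.sym (from∘to z)) (inverseʳ eq))

    open Complement (complement (index-≢ x≉y))

    Survives : Carrier → Set ℓ₁
    Survives z = ¬ z ≈ x × ¬ z ≈ y

    survives : ∀ k → Survives (from (embed k))
    survives k = proj₁ (avoids k) ∘ from-≈⇒≡to , proj₂ (avoids k) ∘ from-≈⇒≡to

    restrict : ∀ {z} → Survives z → ∃ λ k → from (embed k) ≈ z
    restrict {z} (z≉x , z≉y) with surjective (to z) (index-≢ z≉x) (index-≢ z≉y)
    ... | k , eq = k , inverseʳ eq

    Survives-∨ : ∀ {z w} → Survives z → Survives w → Survives (z ∨ w)
    Survives-∨ (z≉x , z≉y) (w≉x , w≉y) =
      joinIrreducible-∨ (proj₁ x-irr) z≉x w≉x , joinIrreducible-∨ (proj₁ y-irr) z≉y w≉y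

    Survives-∧ : ∀ {z w} → Survives z → Survives w → Survives (z ∧ w)
    Survives-∧ (z≉x , z≉y) (w≉x , w≉y) =
      meetIrreducible-∧ (proj₂ x-irr) z≉x w≉x , meetIrreducible-∧ (proj₂ y-irr) z≉y w≉y

    embed-≈-injective : ∀ {k l} → from (embed k) ≈ from (embed l) → k ≡ l
    embed-≈-injective eq = injective (≡.trans (from-≈⇒≡to eq) (inverseˡ Eq.refl))

    open Sublattice Survives Survives-∨ Survives-∧ (from ∘ embed) survives embed-≈-injective restrict
      public

    private module M = FiniteLattice sublattice

    size-sublattice : size ≡ 2 + M.size
    size-sublattice = size≡

    ∣↑∣-split : ∀ z → ∣ ↑ ι z ∣ ≡
      indicator (does (ι z ≤? from (to x))) + (indicator (does (ι z ≤? from (to y))) + ∣ M.↑ z ∣)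
    ∣↑∣-split z = ≡.trans (card-split _)
      (≡.cong (λ t → indicator (does (ι z ≤? from (to x))) + (indicator (does (ι z ≤? from (to y))) + t))
              (≡.sym (∣↑∣-sublattice z)))

    ∣↑∣≤2+ : ∀ z → ∣ ↑ ι z ∣ ℕ.≤ 2 + ∣ M.↑ z ∣
    ∣↑∣≤2+ z = ℕ.≤-trans (ℕ.≤-reflexive (∣↑∣-split z))
      (ℕ.+-mono-≤ (indicator≤1 (does (ι z ≤? from (to x))))
        (ℕ.+-monoˡ-≤ _ (indicator≤1 (does (ι z ≤? from (to y))))))

    ∣↑∣-unchanged : ∀ {z} → ¬ ι z ≤ x → ¬ ι z ≤ y → ∣ ↑ ι z ∣ ≡ ∣ M.↑ z ∣
    ∣↑∣-unchanged {z} z≰x z≰y = ≡.trans (∣↑∣-split z)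
      (≡.cong₂ (λ b c → indicator b + (indicator c + ∣ M.↑ z ∣))
        (dec-false (ι z ≤? from (to x)) (λ z≤x → z≰x (trans z≤x (reflexive (from∘to x)))))
        (dec-false (ι z ≤? from (to y)) (λ z≤y → z≰y (trans z≤y (reflexive (from∘to y))))))

    -- The two hypotheses make every lower cover of `ι z` survive, so each is also a lower cover in
    -- the sublattice, where there is only one.
    joinIrreducible-lift : ∀ {z} → ¬ ι z UpperCovers x → ¬ ι z UpperCovers y →
                           M.JoinIrreducible z → JoinIrreducible (ι z)
    joinIrreducible-lift {z} ¬zx ¬zy (w , (w<z , none) , unique) =
      ι w , (w<z , none-between) , unique′
      where
      cover-survives : ∀ {v} → ι z UpperCovers v → Survives v
      cover-survives {v} (v<z , gap) =
        (λ v≈x → ¬zx (<-respˡ-≈ v≈x v<z , λ t (x<t , t<z) → gap t (<-respˡ-≈ (Eq.sym v≈x) x<t , t<z))) ,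
        (λ v≈y → ¬zy (<-respˡ-≈ v≈y v<z , λ t (y<t , t<z) → gap t (<-respˡ-≈ (Eq.sym v≈y) y<t , t<z)))

      none-between : ∀ t → ¬ (ι w < t × t < ι z)
      -- Since `t` may itself be deleted, it is replaced by a lower cover of `ι z` above it, which
      -- survives.
      none-between t (w<t , t<z) with lower-cover t<z
      ... | v , t≤v , cov@(v<z , _) with restrict (cover-survives cov)
      ...   | v′ , v′≈v = none (lift v′)
        ( <-respʳ-≈ (Eq.sym v′≈v) (<-≤-trans w<t t≤v)
        , <-respˡ-≈ (Eq.sym v′≈v) v<z )

      unique′ : ∀ {v} → ι z UpperCovers v → ι w ≈ v
      unique′ cov@(v<z , gap) with restrict (cover-survives cov)
      ... | v′ , v′≈v = Eq.trans
        (unique {lift v′} (<-respˡ-≈ (Eq.sym v′≈v) v<z ,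
                           λ t (v′<t , t<z) → gap (ι t) (<-respˡ-≈ v′≈v v′<t , t<z)))
        v′≈v

    -- Bounds `b` and `t` with `b < x < t` and `b < y < t` both survive, and they are distinct.
    1<size-sublattice : 1 ℕ.< M.size
    1<size-sublattice = two-elements
      (common-lower-bound (proj₁ x-irr) (proj₁ y-irr))
      (common-upper-bound (proj₂ x-irr) (proj₂ y-irr))
      where
      two-elements : (∃ λ b → b < x × b < y) → (∃ λ t → x < t × y < t) → 1 ℕ.< M.size
      two-elements (b , b<x , b<y) (t , x<t , y<t)
        with restrict (proj₂ b<x , proj₂ b<y)
           | restrict (proj₂ x<t ∘ Eq.sym , proj₂ y<t ∘ Eq.sym)
      ... | b′ , b≈ | t′ , t≈ = distinct⇒1< λ b≡t → proj₂ (<-trans b<x x<t)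
        (Eq.trans (Eq.sym b≈) (Eq.trans (Eq.reflexive (≡.cong (from ∘ embed) b≡t)) t≈))

    -- Join-irreducibles of the sublattice still have large up-sets.

    module _ (large : ∀ j → JoinIrreducible j → size ℕ.< 2 * ∣ ↑ j ∣) where

      -- The deletion lowers the size by exactly 2, while a loss of at most 1 in the up-set costs at
      -- most 2 after doubling.
      large-witness : ∀ {z} w → size ℕ.< 2 * ∣ ↑ w ∣ → ∣ ↑ w ∣ ℕ.≤ 1 + ∣ M.↑ z ∣ →
                      M.size ℕ.< 2 * ∣ M.↑ z ∣
      large-witness {z} w w-large w≤ = ℕ.+-cancelˡ-< 2 _ _ (begin-strict
        2 + M.size          ≡⟨ size-sublattice ⟨
        size                <⟨ w-large ⟩
        2 * ∣ ↑ w ∣         ≤⟨ ℕ.*-monoʳ-≤ 2 w≤ ⟩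
        2 * (1 + ∣ M.↑ z ∣) ≡⟨ ℕ.*-distribˡ-+ 2 1 ∣ M.↑ z ∣ ⟩
        2 + 2 * ∣ M.↑ z ∣   ∎)
        where open ℕ.≤-Reasoning

      large-below : ∀ {z w} → JoinIrreducible w → ι z < w → M.size ℕ.< 2 * ∣ M.↑ z ∣
      large-below {z} {w} w-ji z<w = large-witness {z} w (large w w-ji)
        -- The deletion may cost two elements, but `ι z` belongs to its own up-set and not to that
        -- of `w`, which regains one.
        (ℕ.≤-pred (ℕ.≤-trans (∣↑∣-anti-< z<w) (∣↑∣≤2+ z)))

      large-cover : ∀ {z w} → ¬ ι z ≤ x → ¬ ι z ≤ y → DoublyIrreducible w →
                    ι z UpperCovers w → M.size ℕ.< 2 * ∣ M.↑ z ∣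
      large-cover {z} {w} z≰x z≰y (w-ji , w-mi) z-covers-w = large-witness {z} w (large w w-ji)
        (ℕ.≤-trans (∣↑∣-upper-cover w-mi z-covers-w)
                   (ℕ.≤-reflexive (≡.cong ℕ.suc (∣↑∣-unchanged {z} z≰x z≰y))))

      large-otherwise : ∀ {z} → ¬ ι z ≤ x → ¬ ι z ≤ y → M.JoinIrreducible z →
                        M.size ℕ.< 2 * ∣ M.↑ z ∣
      -- Covering is not decided directly. The goal is decidable, so its negation `small` may be
      -- assumed; a covering of `x` or `y` would then contradict it through `large-cover`.
      large-otherwise {z} z≰x z≰y z-ji = decidable-stable (_ ℕ.<? _) λ small →
        small (large-witness {z} (ι z)
          (large (ι z) (joinIrreducible-lift
            (small ∘ large-cover {z} z≰x z≰y x-irr)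
            (small ∘ large-cover {z} z≰x z≰y y-irr)
            z-ji))
          (ℕ.m≤n⇒m≤1+n (ℕ.≤-reflexive (∣↑∣-unchanged {z} z≰x z≰y))))

      large-sublattice : ∀ z → M.JoinIrreducible z → M.size ℕ.< 2 * ∣ M.↑ z ∣
      large-sublattice z z-ji = by-cases (ι z ≤? x) (ι z ≤? y)
        where
        by-cases : Dec (ι z ≤ x) → Dec (ι z ≤ y) → M.size ℕ.< 2 * ∣ M.↑ z ∣
        -- The inequality is strict because `ι z` survives while `x` does not; likewise for `y`.
        by-cases (yes z≤x) _ = large-below {z} (proj₁ x-irr) (z≤x , proj₁ (survives (lower z)))
        by-cases (no _) (yes z≤y) = large-below {z} (proj₁ y-irr) (z≤y , proj₂ (survives (lower z)))
        by-cases (no z≰x) (no z≰y) = large-otherwise {z} z≰x z≰y z-ji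

theorem2p6 : {c ℓ₁ ℓ₂ : Level} (L : FiniteLattice c ℓ₁ ℓ₂) →
    IsMinimumSizeCounterexample L →
    (x y : FiniteLattice.Carrier L) →
    FiniteLattice.DoublyIrreducible L x →
    FiniteLattice.DoublyIrreducible L y →
    FiniteLattice._≈_ L x y
-- Equality in a finite lattice is decidable, so it suffices to refute `x≉y`.
theorem2p6 L ((_ , large) , minimal) x y x-irr y-irr = decidable-stable (x ≟ y) λ x≉y →
  let open FiniteLatticeProperties.Deletion L x-irr y-irr x≉y in
  minimal sublattice (1<size-sublattice , large-sublattice large)
    -- The sublattice is smaller by two, one more than strictness requires.
    (ℕ.≤-trans (ℕ.n≤1+n _) (ℕ.≤-reflexive (≡.sym size-sublattice)))
  where open FiniteLattice L using (_≟_)
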